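{- Let $\Sigma$ be a first-order language and $n\ge 1$ a natural number, and let $\mathcal{T}_{\Sigma,n}$ be the family of all complete theories in $\Sigma$ having $n$-element models. If $\Sigma$ is finite, or if $n=1$ and $\Sigma$ has only finitely many predicate symbols, then ${\rm RS}(\mathcal{T}_{\Sigma,n})=0$; otherwise ${\rm RS}(\mathcal{T}_{\Sigma,n})=\infty$.
   Context: Theories are complete consistent first-order theories; structures have nonempty universes. Function symbols (constants being $0$-ary function symbols) are treated via their graphs: each $n$-ary function symbol $f$ is replaced by an $(n+1)$-ary predicate $R_f=\{(\bar a,b)\mid f(\bar a)=b\}$, and sentences are those of the resulting relational language. For a family $\mathcal{T}$ of theories and a sentence $\varphi$ of its language, $\mathcal{T}_\varphi=\{T\in\mathcal{T}\mid\varphi\in T\}$. The rank ${\rm RS}$ of a family is defined as follows: ${\rm RS}(\emptyset)=-1$; ${\rm RS}(\mathcal{T})=0$ for finite nonempty $\mathcal{T}$; ${\rm RS}(\mathcal{T})\ge 1$ for infinite $\mathcal{T}$; for $\alpha=\beta+1$, ${\rm RS}(\mathcal{T})\ge\alpha$ iff there are pairwise inconsistent sentences $\varphi_k$, $k\in\omega$, of the language of $\mathcal{T}$ with ${\rm RS}(\mathcal{T}_{\varphi_k})\ge\beta$ for all $k$; for limit $\alpha$, ${\rm RS}(\mathcal{T})\ge\alpha$ iff ${\rm RS}(\mathcal{T})\ge\beta$ for all $\beta<\alpha$; ${\rm RS}(\mathcal{T})=\alpha$ iff ${\rm RS}(\mathcal{T})\ge\alpha$ and not ${\rm RS}(\mathcal{T})\ge\alpha+1$;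 ${\rm RS}(\mathcal{T})=\infty$ if ${\rm RS}(\mathcal{T})\ge\alpha$ for every ordinal $\alpha$. -}

module Defs where

open import Data.Fin.Base using (Fin)
open import Data.List.Relation.Unary.Enumerates.Setoid using (IsEnumeration)
open import Data.Nat.Base using (ℕ; zero; suc)
open import Data.Product.Base using (∃; _×_; proj₁)
open import Data.Sum.Base using (_⊎_)
open import Data.Vec.Base using (Vec; []; _∷_; lookup; map)
open import Function.Base using (_∘_)
open import Function.Bundles using (_↔_)
open import Level using (Level; _⊔_) renaming (suc to lsuc)
open import Relation.Binary.Bundles using (Setoid)
open import Relation.Binary.PropositionalEquality using (_≡_; _≢_; setoid)
import Relation.Binary.Construct.On as On
open import Relation.Nullary.Negation using (¬_)
open import Relation.Unary using (Pred; _∈_; Empty; Satisfiable)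
open import Relation.Unary.Relation.Binary.Equality using (≐-setoid)

FiniteSetoid : {a b : Level} → Setoid a b → Set (a ⊔ b)
FiniteSetoid S = ∃ (IsEnumeration S)

FiniteSet : {a : Level} → Set a → Set a
FiniteSet A = FiniteSetoid (setoid A)

-- Constants are function symbols of arity 0; predicate symbols of arity
-- 0 are allowed.
record Language (ℓ : Level) : Set (lsuc ℓ) where
  field
    PredSym   : Set ℓ
    predArity : PredSym → ℕ
    FunSym    : Set ℓ
    funArity  : FunSym → ℕ

FiniteLanguage : {ℓ : Level} → Language ℓ → Set ℓ
FiniteLanguage L = FiniteSet PredSym × FiniteSet FunSym
  where open Language L

module _ {ℓ : Level} (L : Language ℓ) where
  open Language L

  -- Formulas with free variables among m de Bruijn indices.  There are no
  -- terms: a function symbol f occurs only through its graph, R_f(x̄,y)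
  -- being `graph f x̄ y`.
  data Formula (m : ℕ) : Set ℓ where
    equal : Fin m → Fin m → Formula m
    rel   : (P : PredSym) → Vec (Fin m) (predArity P) → Formula m
    graph : (f : FunSym) → Vec (Fin m) (funArity f) → Fin m → Formula m
    not   : Formula m → Formula m
    and   : Formula m → Formula m → Formula m
    or    : Formula m → Formula m → Formula m
    imp   : Formula m → Formula m → Formula m
    all   : Formula (suc m) → Formula m
    ex    : Formula (suc m) → Formula m

  Sentence : Set ℓ
  Sentence = Formula 0

  record Structure : Set (lsuc ℓ) where
    field
      Carrier  : Set ℓ
      nonempty : Carrier
      relᴹ     : (P : PredSym) → Pred (Vec Carrier (predArity P)) ℓ
      funᴹ     : (f : FunSym) → Vec Carrier (funArity f) → Carrier

module _ {ℓ : Level} {L : Language ℓ} where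

  module _ (M : Structure L) where
    open Structure M

    Sat : {m : ℕ} → Vec Carrier m → Formula L m → Set ℓ
    Sat ρ (equal x y)    = lookup ρ x ≡ lookup ρ y
    Sat ρ (rel P xs)     = relᴹ P (map (lookup ρ) xs)
    Sat ρ (graph f xs y) = funᴹ f (map (lookup ρ) xs) ≡ lookup ρ y
    Sat ρ (not φ)        = ¬ Sat ρ φ
    Sat ρ (and φ ψ)      = Sat ρ φ × Sat ρ ψ
    Sat ρ (or φ ψ)       = Sat ρ φ ⊎ Sat ρ ψ
    Sat ρ (imp φ ψ)      = Sat ρ φ → Sat ρ ψ
    Sat ρ (all φ)        = ∀ a → Sat (a ∷ ρ) φ
    Sat ρ (ex φ)         = ∃ λ a → Sat (a ∷ ρ) φ

    HasCardinality : ℕ → Set ℓ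
    HasCardinality n = Carrier ↔ Fin n

  infix 4 _⊨_ _⊨ₛ_

  _⊨_ : Structure L → Sentence L → Set ℓ
  M ⊨ φ = Sat M [] φ

  _⊨ₛ_ : Structure L → Pred (Sentence L) ℓ → Set ℓ
  M ⊨ₛ S = ∀ φ → φ ∈ S → M ⊨ φ

  -- Consistency is having a model.  Models interpret every R_f by the
  -- graph of a function.
  Consistent : Pred (Sentence L) ℓ → Set (lsuc ℓ)
  Consistent S = ∃ λ M → M ⊨ₛ S

  Inconsistent₂ : Sentence L → Sentence L → Set (lsuc ℓ)
  Inconsistent₂ φ ψ = ∀ M → ¬ (M ⊨ φ × M ⊨ ψ)

-- Closure under consequence follows from the two conditions.
record Theory {ℓ : Level} (L : Language ℓ) : Set (lsuc ℓ) where
  field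
    sentences  : Pred (Sentence L) ℓ
    consistent : Consistent sentences
    complete   : ∀ φ → φ ∈ sentences ⊎ not φ ∈ sentences

open Theory

Family : {ℓ : Level} → Language ℓ → Set (lsuc (lsuc ℓ))
Family {ℓ} L = Pred (Theory L) (lsuc ℓ)

module _ {ℓ : Level} {L : Language ℓ} where

  -- Two members of a family are equal when they contain the same sentences.
  members : Family L → Setoid (lsuc ℓ) ℓ
  members 𝒯 = On.setoid {B = ∃ 𝒯} (≐-setoid (Sentence L) ℓ) (sentences ∘ proj₁)

  FiniteFamily : Family L → Set (lsuc ℓ)
  FiniteFamily 𝒯 = FiniteSetoid (members 𝒯)

  infixl 7 _∣_

  _∣_ : Family L → Sentence L → Family L
  (𝒯 ∣ φ) T = T ∈ 𝒯 × φ ∈ sentences T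

𝒯[_,_] : {ℓ : Level} (L : Language ℓ) → ℕ → Family L
𝒯[ L , n ] T = ∃ λ (M : Structure L) → M ⊨ₛ sentences T × HasCardinality M n

-- Ordinals as well-founded trees: a limit is given by an inhabited family
-- without a greatest value, indexed by any I : Set o, and denotes its
-- supremum.  The conditions on `lim` exclude suprema that are zero or
-- successors.  As in any tree presentation an ordinal may have several
-- notations.
data Ord (o : Level) : Set (lsuc o)
data _≤ᵒ_ {o : Level} : Ord o → Ord o → Set (lsuc o)

infix 4 _≤ᵒ_ _<ᵒ_

data Ord o where
  zero : Ord o
  suc  : Ord o → Ord o
  lim  : (I : Set o) (f : I → Ord o) → I → (∀ i → ∃ λ j → suc (f i) ≤ᵒ f j) → Ord o

data _≤ᵒ_ {o} where
  zero≤   : {α : Ord o} → zero ≤ᵒ α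
  suc≤suc : {α β : Ord o} → α ≤ᵒ β → suc α ≤ᵒ suc β
  ≤lim    : {α : Ord o} {I : Set o} {f : I → Ord o} {i₀ : I}
            {inc : ∀ i → ∃ λ j → suc (f i) ≤ᵒ f j}
            (i : I) → α ≤ᵒ f i → α ≤ᵒ lim I f i₀ inc
  lim≤    : {β : Ord o} {I : Set o} {f : I → Ord o} {i₀ : I}
            {inc : ∀ i → ∃ λ j → suc (f i) ≤ᵒ f j} →
            (∀ i → f i ≤ᵒ β) → lim I f i₀ inc ≤ᵒ β

_<ᵒ_ : {o : Level} → Ord o → Ord o → Set (lsuc o)
α <ᵒ β = suc α ≤ᵒ β

-- At α = 1 both `infinite` and `splits` are available; for families of
-- complete theories they are classically equivalent.
data RS≥ {ℓ o : Level} {L : Language ℓ} : Ord o → Family L → Set (lsuc (lsuc ℓ) ⊔ lsuc o) where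
  nonempty : {𝒯 : Family L} → Satisfiable 𝒯 → RS≥ zero 𝒯
  infinite : {𝒯 : Family L} → ¬ FiniteFamily 𝒯 → RS≥ (suc zero) 𝒯
  splits   : {𝒯 : Family L} {β : Ord o} (φ : ℕ → Sentence L) →
             (∀ j k → j ≢ k → Inconsistent₂ (φ j) (φ k)) →
             (∀ k → RS≥ β (𝒯 ∣ φ k)) → RS≥ (suc β) 𝒯
  limit    : {𝒯 : Family L} {I : Set o} {f : I → Ord o} {i₀ : I}
             {inc : ∀ i → ∃ λ j → suc (f i) ≤ᵒ f j} →
             (∀ β → β <ᵒ lim I f i₀ inc → RS≥ β 𝒯) → RS≥ (lim I f i₀ inc) 𝒯

data Rank (o : Level) : Set (lsuc o) where
  -1ᵣ ∞ᵣ : Rank o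
  ord    : Ord o → Rank o

infix 4 RS_≈_

-- Several clauses may apply at once (a finite nonempty family also satisfies
-- the hypotheses of `exact` at α = 0), but they then give the same rank.
data RS_≈_ {ℓ o : Level} {L : Language ℓ} (𝒯 : Family L) : Rank o → Set (lsuc (lsuc ℓ) ⊔ lsuc o) where
  empty     : Empty 𝒯 → RS 𝒯 ≈ -1ᵣ
  finite    : Satisfiable 𝒯 → FiniteFamily 𝒯 → RS 𝒯 ≈ ord zero
  exact     : {α : Ord o} → RS≥ α 𝒯 → ¬ RS≥ (suc α) 𝒯 → RS 𝒯 ≈ ord α
  unbounded : (∀ (α : Ord o) → RS≥ α 𝒯) → RS 𝒯 ≈ ∞ᵣ

{-# OPTIONS --safe #-}

-- A complete theory with an n-element model is determined by the atomic facts
-- of that model, its elements being named by Fin n.  In the finite cases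
-- finitely many atomic facts matter (for n = 1 graphs of functions are trivial),
-- so there are finitely many theories.  Otherwise there are sentences
-- θ₀, θ₁, … whose truth values can be prescribed arbitrarily in n-element
-- structures: "P_k holds somewhere on the diagonal", or "f_{k+1} and f₀ agree
-- somewhere on the diagonal".  Then ¬θ₀ ∧ … ∧ ¬θ_{k-1} ∧ θ_k, k ∈ ω, are pairwise
-- inconsistent, and each of them leaves the tail θ_{k+1}, θ_{k+2}, … independent,
-- so the family can be split again through all ordinals.
module Submission where

open import Defs
open import Axiom.ExcludedMiddle using (ExcludedMiddle)
open import Data.Bool.Base using (Bool; true; false; T)
open import Data.Empty using (⊥-elim)
open import Data.Fin.Base using (Fin; zero; suc)
open import Data.List.Base as List using (List; []; _∷_; _++_; [_])
open import Data.List.Membership.Propositional using (_∈_; _∉_; lose)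
open import Data.List.Membership.Propositional.Properties
  using (∈-++⁺ˡ; ∈-++⁺ʳ; ∈-map⁺; ∈-concatMap⁺; ∈-cartesianProductWith⁺; ∈-allFin)
open import Data.List.Relation.Unary.All as All using (All; []; _∷_)
open import Data.List.Relation.Unary.Any as Any using (Any; here; there)
open import Data.List.Relation.Unary.Any.Properties using (++⁺ˡ; ++⁺ʳ)
open import Data.Nat.Base using (ℕ; zero; suc; _≥_; _+_; _<_; _≤′_; ≤′-refl; ≤′-step)
open import Data.Nat.Properties using (<-cmp; ≤⇒≤′; suc-injective)
open import Data.Product.Base using (∃; Σ; _×_; _,_; proj₁; proj₂)
open import Data.Product.Function.NonDependent.Propositional using (_×-⇔_)
open import Data.Sum.Base using (_⊎_; inj₁; inj₂; [_,_]′)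
open import Data.Sum.Function.Propositional using (_⊎-⇔_)
open import Data.Unit.Polymorphic using (⊤; tt)
open import Data.Vec.Base as Vec using (Vec; []; _∷_; lookup; map; replicate)
open import Data.Vec.Properties using (map-∘; map-cong; lookup-map)
open import Function.Base using (_∘_; id; const)
open import Function.Bundles using (_⇔_; mk⇔; Equivalence; Injection; Inverse; mk↔ₛ′)
open import Function.Definitions using (Injective)
open import Function.Properties.Inverse using (↔⇒↣; ↔-sym)
open import Function.Properties.Equivalence using () renaming (refl to ⇔-refl; sym to ⇔-sym; trans to ⇔-trans)
open import Level using (Level; Lift; lift; lower) renaming (suc to lsuc)
open import Relation.Binary.Definitions using (tri<; tri≈; tri>)
open import Relation.Binary.PropositionalEquality using (_≡_; _≢_; refl; sym; trans; cong; cong₂; subst)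
open import Relation.Nullary.Decidable.Core using (yes; no)
open import Relation.Nullary.Negation using (¬_; contradiction)
open import Relation.Unary using (Pred)

open Equivalence using (to; from)
open Theory

private variable
  a b ℓ o : Level
  L : Language ℓ

≡⇒⇔ : {A B : Set a} → A ≡ B → A ⇔ B
≡⇒⇔ refl = ⇔-refl

-- Finite sets

Σ-finite : {A : Set a} {B : A → Set b} →
           FiniteSet A → (∀ x → FiniteSet (B x)) → FiniteSet (Σ A B)
Σ-finite (xs , all-xs) fin =
  List.concatMap pairs xs ,
  λ (x , y) → ∈-concatMap⁺ pairs (lose (all-xs x) (∈-map⁺ (x ,_) (proj₂ (fin x) y)))
  where pairs = λ x → List.map (x ,_) (proj₁ (fin x))

⊎-finite : {A : Set a} {B : Set b} → FiniteSet A → FiniteSet B → FiniteSet (A ⊎ B)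
⊎-finite (xs , all-xs) (ys , all-ys) =
  List.map inj₁ xs ++ List.map inj₂ ys ,
  λ { (inj₁ x) → ∈-++⁺ˡ (∈-map⁺ inj₁ (all-xs x))
    ; (inj₂ y) → ∈-++⁺ʳ (List.map inj₁ xs) (∈-map⁺ inj₂ (all-ys y)) }

Fin-finite : ∀ n → FiniteSet (Fin n)
Fin-finite n = List.allFin n , ∈-allFin

Vec-finite : {A : Set a} → FiniteSet A → ∀ k → FiniteSet (Vec A k)
Vec-finite fin zero = [ [] ] , λ { [] → here refl }
Vec-finite (xs , all-xs) (suc k) =
  let yss , all-yss = Vec-finite (xs , all-xs) k in
  List.cartesianProductWith _∷_ xs yss ,
  λ { (x ∷ ys) → ∈-cartesianProductWith⁺ _∷_ (all-xs x) (all-yss ys) }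

-- The order on ordinal notations

≤ᵒ-refl : {α : Ord o} → α ≤ᵒ α
≤ᵒ-refl {α = zero}          = zero≤
≤ᵒ-refl {α = suc α}         = suc≤suc ≤ᵒ-refl
≤ᵒ-refl {α = lim I f i inc} = lim≤ λ j → ≤lim j ≤ᵒ-refl

≤ᵒ-trans : {α β γ : Ord o} → α ≤ᵒ β → β ≤ᵒ γ → α ≤ᵒ γ
≤ᵒ-trans zero≤       q           = zero≤
≤ᵒ-trans (suc≤suc p) (suc≤suc q) = suc≤suc (≤ᵒ-trans p q)
≤ᵒ-trans (suc≤suc p) (≤lim i q)  = ≤lim i (≤ᵒ-trans (suc≤suc p) q)
≤ᵒ-trans (≤lim i p)  (lim≤ q)    = ≤ᵒ-trans p (q i)
≤ᵒ-trans (≤lim i p)  (≤lim j q)  = ≤lim j (≤ᵒ-trans (≤lim i p) q)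
≤ᵒ-trans (lim≤ p)    q           = lim≤ λ i → ≤ᵒ-trans (p i) q

-- Atomic facts of models with elements named by `Fin n`

Atom : Language ℓ → ℕ → Set ℓ
Atom L n = (Σ PredSym λ P → Vec (Fin n) (predArity P)) ⊎
           (Σ FunSym λ f → Vec (Fin n) (funArity f) × Fin n)
  where open Language L

module _ {n : ℕ} where

  Holds : (∃ λ (M : Structure L) → HasCardinality M n) → Atom L n → Set _
  Holds (M , ι) (inj₁ (P , is))     = Structure.relᴹ M P (map (Inverse.from ι) is)
  Holds (M , ι) (inj₂ (f , is , j)) =
    Structure.funᴹ M f (map (Inverse.from ι) is) ≡ Inverse.from ι j

  module _ (M M′ : Structure L) (ι : HasCardinality M n) (ι′ : HasCardinality M′ n)
           (agree : ∀ A → Holds (M , ι) A ⇔ Holds (M′ , ι′) A) where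

    private
      e = Inverse.from ι
      e′ = Inverse.from ι′

      map-lookup-map : ∀ {A : Set a} (g : Fin n → A) {m k} (xs : Vec (Fin n) m) (ys : Vec (Fin m) k) →
                       map (lookup (map g xs)) ys ≡ map g (map (lookup xs) ys)
      map-lookup-map g xs ys =
        trans (map-cong (λ i → lookup-map i g xs) ys) (map-∘ g (lookup xs) ys)

      -- Naming is injective, so equality of named elements depends on the indices alone; this is
      -- why `Atom` has no equality case.
      equal-⇔ : ∀ {N : Structure L} (κ : HasCardinality N n) {m} (xs : Vec (Fin n) m) i j →
                Sat N (map (Inverse.from κ) xs) (equal i j) ⇔ (lookup xs i ≡ lookup xs j)
      equal-⇔ {N} κ xs i j =
        ⇔-trans (≡⇒⇔ (cong₂ _≡_ (lookup-map i _ xs) (lookup-map j _ xs)))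
                (mk⇔ (Injection.injective (↔⇒↣ (↔-sym κ))) (cong (Inverse.from κ)))

    -- Induction on the formula, with every valuation given by a vector of names. Quantifiers use
    -- surjectivity: each element of either model has a name, and the element of the same name
    -- serves in the other.
    atoms-determine : ∀ {m} (φ : Formula L m) (xs : Vec (Fin n) m) →
                      Sat M (map e xs) φ ⇔ Sat M′ (map e′ xs) φ
    atoms-determine (equal i j) xs =
      ⇔-trans (equal-⇔ {M} ι xs i j) (⇔-sym (equal-⇔ {M′} ι′ xs i j))
    atoms-determine (rel P ys) xs =
      ⇔-trans (≡⇒⇔ (cong (Structure.relᴹ M P) (map-lookup-map e xs ys)))
      (⇔-trans (agree (inj₁ (P , _)))
               (⇔-sym (≡⇒⇔ (cong (Structure.relᴹ M′ P) (map-lookup-map e′ xs ys)))))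
    atoms-determine (graph f ys j) xs =
      ⇔-trans (≡⇒⇔ (cong₂ (λ v y → Structure.funᴹ M f v ≡ y) (map-lookup-map e xs ys) (lookup-map j e xs)))
      (⇔-trans (agree (inj₂ (f , _ , _)))
               (⇔-sym (≡⇒⇔ (cong₂ (λ v y → Structure.funᴹ M′ f v ≡ y) (map-lookup-map e′ xs ys) (lookup-map j e′ xs)))))
    atoms-determine (not φ) xs =
      let h = atoms-determine φ xs in mk⇔ (_∘ from h) (_∘ to h)
    atoms-determine (and φ ψ) xs = atoms-determine φ xs ×-⇔ atoms-determine ψ xs
    atoms-determine (or φ ψ) xs = atoms-determine φ xs ⊎-⇔ atoms-determine ψ xs
    atoms-determine (imp φ ψ) xs =
      let h = atoms-determine φ xs; k = atoms-determine ψ xs in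
      mk⇔ (λ s → to k ∘ s ∘ from h) (λ s → from k ∘ s ∘ to h)
    atoms-determine (all φ) xs = mk⇔
      (λ s a → subst (λ x → Sat M′ (x ∷ map e′ xs) φ) (Inverse.strictlyInverseʳ ι′ a)
                 (to (atoms-determine φ (_ ∷ xs)) (s _)))
      (λ s a → subst (λ x → Sat M (x ∷ map e xs) φ) (Inverse.strictlyInverseʳ ι a)
                 (from (atoms-determine φ (_ ∷ xs)) (s _)))
    atoms-determine (ex φ) xs = mk⇔
      (λ (a , s) → _ , to (atoms-determine φ (Inverse.to ι a ∷ xs))
        (subst (λ x → Sat M (x ∷ map e xs) φ) (sym (Inverse.strictlyInverseʳ ι a)) s))
      (λ (a , s) → _ , from (atoms-determine φ (Inverse.to ι′ a ∷ xs))
        (subst (λ x → Sat M′ (x ∷ map e′ xs) φ) (sym (Inverse.strictlyInverseʳ ι′ a)) s))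

-- Pairwise inconsistent sentences

firstTrue : (ℕ → Sentence L) → ℕ → Sentence L
firstTrue θ zero    = θ zero
firstTrue θ (suc k) = and (not (θ zero)) (firstTrue (θ ∘ suc) k)

firstTrue-inconsistent : ∀ (θ : ℕ → Sentence L) j k → j ≢ k →
                         Inconsistent₂ (firstTrue θ j) (firstTrue θ k)
firstTrue-inconsistent θ zero    zero    j≢k M _                     = j≢k refl
firstTrue-inconsistent θ zero    (suc k) j≢k M (s , (¬s , _))        = ¬s s
firstTrue-inconsistent θ (suc j) zero    j≢k M ((¬s , _) , s)        = ¬s s
firstTrue-inconsistent θ (suc j) (suc k) j≢k M ((_ , s) , (_ , s′)) =
  firstTrue-inconsistent (θ ∘ suc) j k (j≢k ∘ cong suc) M (s , s′)

-- The truth pattern 0...01g with k zeros: it makes `firstTrue θ k` true and leaves all later values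
-- free to follow `g`.
false*true++ : ℕ → (ℕ → Bool) → ℕ → Bool
false*true++ zero    g zero    = true
false*true++ zero    g (suc j) = g j
false*true++ (suc k) g zero    = false
false*true++ (suc k) g (suc j) = false*true++ k g j

false*true++-tail : ∀ k g j → false*true++ k g (suc (k + j)) ≡ g j
false*true++-tail zero    g j = refl
false*true++-tail (suc k) g j = false*true++-tail k g j

firstTrue-holds : ∀ (M : Structure L) θ k g → (∀ j → M ⊨ θ j ⇔ T (false*true++ k g j)) →
                  M ⊨ firstTrue θ k
firstTrue-holds M θ zero    g h = from (h zero) _
firstTrue-holds M θ (suc k) g h = to (h zero) , firstTrue-holds M (θ ∘ suc) k g (h ∘ suc)

-- Finite and infinite sets under excluded middle

module _ (em : ∀ {a : Level} → ExcludedMiddle a) where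

  -- Each `Q i` cuts the region `D` in two, and each nonempty cell left at the end supplies one
  -- representative. `D` varies so that the induction can pass to a half; the representative is kept
  -- in `D` so that it agrees with `x` on the predicate of the cut.
  partition-cover : {X : Set a} {I : Set b} (Q : I → X → Set ℓ) (D : X → Set ℓ) (is : List I) →
    ∃ λ xs → ∀ x → D x → Any (λ y → D y × All (λ i → Q i x ⇔ Q i y) is) xs
  partition-cover Q D [] with em {P = ∃ D}
  ... | yes (x , d) = [ x ] , λ _ _ → here (d , [])
  ... | no ¬∃D      = [] , λ x d → contradiction (x , d) ¬∃D
  partition-cover {X = X} Q D (i ∷ is)
    with xs , cover-xs ← partition-cover Q (λ x → D x × Q i x) is
       | ys , cover-ys ← partition-cover Q (λ x → D x × ¬ Q i x) is = xs ++ ys , cover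
    where
    cover : ∀ x → D x → Any (λ y → D y × All (λ i → Q i x ⇔ Q i y) (i ∷ is)) (xs ++ ys)
    cover x d with em {P = Q i x}
    ... | yes q = ++⁺ˡ (Any.map (λ ((d′ , q′) , qs) → d′ , mk⇔ (const q′) (const q) ∷ qs)
                                (cover-xs x (d , q)))
    ... | no ¬q = ++⁺ʳ xs (Any.map (λ ((d′ , ¬q′) , qs) →
                                      d′ , mk⇔ (⊥-elim ∘ ¬q) (⊥-elim ∘ ¬q′) ∷ qs)
                                   (cover-ys x (d , ¬q)))

  classify : {X : Set a} {I : Set b} (Q : I → X → Set ℓ) → FiniteSet I →
    ∃ λ xs → ∀ x → Any (λ y → ∀ i → Q i x ⇔ Q i y) xs
  classify Q (is , all-is) =
    let xs , cover = partition-cover Q (const ⊤) is in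
    xs , λ x → Any.map (λ (_ , qs) i → All.lookup qs (all-is i)) (cover x tt)

  -- No list exhausts an infinite type, so each term can be chosen outside the list of its
  -- predecessors.
  infinite⇒sequence : {A : Set a} → ¬ FiniteSet A → ∃ λ (s : ℕ → A) → Injective _≡_ _≡_ s
  infinite⇒sequence {A = A} inf = s , s-injective
    where
    fresh : (xs : List A) → ∃ (_∉ xs)
    fresh xs with em {P = ∃ (_∉ xs)}
    ... | yes x = x
    ... | no ¬x = contradiction (xs , λ x → membership x) inf
      where
      membership : ∀ x → x ∈ xs
      membership x with em {P = x ∈ xs}
      ... | yes p = p
      ... | no ¬p = contradiction (x , ¬p) ¬x

    initial : ℕ → List A
    initial zero    = []
    initial (suc k) = proj₁ (fresh (initial k)) ∷ initial k

    s : ℕ → A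
    s k = proj₁ (fresh (initial k))

    s∈initial : ∀ {j k} → suc j ≤′ k → s j ∈ initial k
    s∈initial ≤′-refl       = here refl
    s∈initial (≤′-step j<k) = there (s∈initial j<k)

    s-distinct : ∀ {j k} → j < k → s j ≢ s k
    s-distinct {k = k} j<k eq =
      proj₂ (fresh (initial k)) (subst (_∈ initial k) eq (s∈initial (≤⇒≤′ j<k)))

    s-injective : Injective _≡_ _≡_ s
    s-injective {j} {k} eq with <-cmp j k
    ... | tri< j<k _ _ = contradiction eq (s-distinct j<k)
    ... | tri≈ _ j≡k _ = j≡k
    ... | tri> _ _ k<j = contradiction (sym eq) (s-distinct k<j)

  -- Complete theories and their models

  Th : Structure L → Theory L
  Th M = record
    { sentences  = M ⊨_
    ; consistent = M , λ _ → id
    ; complete   = complete-Th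
    }
    where
    complete-Th : ∀ φ → M ⊨ φ ⊎ M ⊨ not φ
    complete-Th φ with em {P = M ⊨ φ}
    ... | yes s = inj₁ s
    ... | no ¬s = inj₂ ¬s

  -- Otherwise `not φ` would be in the theory and fail in its model. Hence complete theories with
  -- elementarily equivalent models coincide.
  model⇒∈ : (T : Theory L) {M : Structure L} → M ⊨ₛ sentences T → ∀ {φ} → M ⊨ φ → sentences T φ
  model⇒∈ T M⊨T {φ} s = [ id , (λ ¬φ∈T → contradiction s (M⊨T (not φ) ¬φ∈T)) ]′ (complete T φ)

  -- Independent sentences and unbounded rank

  record Independent {ℓ} {L : Language ℓ} (𝒯 : Family L) : Set (lsuc ℓ) where
    field
      θ      : ℕ → Sentence L
      model  : (ℕ → Bool) → Structure L
      truth  : ∀ g k → model g ⊨ θ k ⇔ T (g k)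
      member : ∀ g → 𝒯 (Th (model g))

  open Independent

  -- All truth patterns are realised, so after the values up to index k are fixed as false, ...,
  -- false, true, the tail of `θ` still takes all patterns.
  independent-∣ : {𝒯 : Family L} (ind : Independent 𝒯) → ∀ k →
                  Independent (𝒯 ∣ firstTrue (θ ind) k)
  independent-∣ ind k = record
    { θ      = λ j → θ ind (suc (k + j))
    ; model  = model ind ∘ false*true++ k
    ; truth  = λ g j → ⇔-trans (truth ind _ _) (≡⇒⇔ (cong T (false*true++-tail k g j)))
    ; member = λ g → member ind _ , firstTrue-holds _ (θ ind) k g (truth ind _)
    }

  -- At a limit all smaller ordinals are required, and these need not be subterms of `α`; so the
  -- recursion is on a strict upper bound `β`.
  independent⇒RS≥-below : (β : Ord o) {α : Ord o} → α <ᵒ β →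
                          {𝒯 : Family L} → Independent 𝒯 → RS≥ α 𝒯
  independent⇒RS≥-below _ {zero} _ ind = nonempty (_ , member ind (const false))
  independent⇒RS≥-below (suc β) {suc α} (suc≤suc α<β) ind =
    splits (firstTrue (θ ind)) (firstTrue-inconsistent (θ ind))
           (λ k → independent⇒RS≥-below β α<β (independent-∣ ind k))
  -- Every `γ` below the limit is strictly below `β`, so the bound descends although the family
  -- stays the same.
  independent⇒RS≥-below (suc β) {lim _ _ _ _} (suc≤suc α≤β) ind =
    limit λ γ γ<α → independent⇒RS≥-below β (≤ᵒ-trans γ<α α≤β) ind
  independent⇒RS≥-below (lim _ f _ _) {suc _} (≤lim i α<fi) ind = independent⇒RS≥-below (f i) α<fi ind
  independent⇒RS≥-below (lim _ f _ _) {lim _ _ _ _} (≤lim i α<fi) ind = independent⇒RS≥-below (f i) α<fi ind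

  independent⇒RS≈∞ : {𝒯 : Family L} → Independent 𝒯 → RS 𝒯 ≈ ∞ᵣ {o}
  independent⇒RS≈∞ ind = unbounded λ α → independent⇒RS≥-below (suc α) ≤ᵒ-refl ind

  module _ {ℓ : Level} (L : Language ℓ) where
    open Language L

    -- Structures on `Fin (suc n)` realising arbitrary truth patterns

    module _ (n : ℕ)
             (R : (P : PredSym) → Pred (Vec (Lift ℓ (Fin (suc n))) (predArity P)) ℓ)
             (F : (f : FunSym) → Vec (Lift ℓ (Fin (suc n))) (funArity f) → Lift ℓ (Fin (suc n))) where

      onFin : Structure L
      onFin = record { Carrier = Lift ℓ (Fin (suc n)); nonempty = lift zero; relᴹ = R; funᴹ = F }

      Th-onFin : 𝒯[ L , suc n ] (Th onFin)
      Th-onFin = onFin , (λ _ → id) , mk↔ₛ′ lower lift (λ _ → refl) (λ _ → refl)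

    -- `s k` is everywhere true or everywhere false according to `g k`; injectivity of `s` keeps
    -- these choices from interfering. Repeating one variable gives a sentence for any arity,
    -- including 0.
    predicates-independent : ∀ n → ¬ FiniteSet PredSym → Independent 𝒯[ L , suc n ]
    predicates-independent n inf = record
      { θ      = λ k → ex (rel (s k) (replicate _ zero))
      ; model  = λ g → onFin n (λ P _ → ∃ λ k → s k ≡ P × T (g k)) (λ _ _ → lift zero)
      ; truth  = λ g k → mk⇔
          (λ (_ , j , eq , t) → subst (T ∘ g) (s-injective eq) t)
          (λ t → lift zero , k , refl , t)
      ; member = λ g → Th-onFin n _ _
      }
      where
      s = proj₁ (infinite⇒sequence inf)
      s-injective = proj₂ (infinite⇒sequence inf)

    -- Values are compared with those of `s 0`, which is constantly `zero`. There are at least two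
    -- elements, so `s (suc k)` can be constantly `suc zero` when `g k` is false and then never
    -- meets `s 0`.
    functions-independent : ∀ n → ¬ FiniteSet FunSym → Independent 𝒯[ L , suc (suc n) ]
    functions-independent n inf = record
      -- Variable 1 is the repeated argument, variable 0 the common value.
      { θ      = λ k → ex (ex (and (graph (s 0) (replicate _ (suc zero)) zero)
                                   (graph (s (suc k)) (replicate _ (suc zero)) zero)))
      ; model  = λ g → onFin (suc n) (λ _ _ → ⊤) (λ f _ → lift (value g f))
      ; truth  = λ g k → mk⇔
          (λ (_ , _ , eq₀ , eq) → agree⇒true g k
             (trans (cong lower (trans eq (sym eq₀))) (value-base g)))
          (λ t → lift zero , lift zero , cong lift (value-base g) , cong lift (true⇒agree g k t))
      ; member = λ g → Th-onFin (suc n) _ _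
      }
      where
      s = proj₁ (infinite⇒sequence inf)
      s-injective : Injective _≡_ _≡_ s
      s-injective = proj₂ (infinite⇒sequence inf)

      Moved : (ℕ → Bool) → FunSym → Set ℓ
      Moved g f = ∃ λ k → s (suc k) ≡ f × ¬ T (g k)

      value : (ℕ → Bool) → FunSym → Fin (suc (suc n))
      value g f with em {P = Moved g f}
      ... | yes _ = suc zero
      ... | no _  = zero

      value-base : ∀ g → value g (s 0) ≡ zero
      value-base g with em {P = Moved g (s 0)}
      -- Moved symbols have successor indices, so `s 0` is never moved.
      ... | yes (k , eq , _) with () ← s-injective eq
      ... | no _ = refl

      agree⇒true : ∀ g k → value g (s (suc k)) ≡ zero → T (g k)
      agree⇒true g k eq with em {P = Moved g (s (suc k))}
      -- The case `yes` is absent because there the value is `suc zero`, against `eq`.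
      ... | no ¬moved with em {P = T (g k)}
      ...   | yes t = t
      ...   | no ¬t = contradiction (k , refl , ¬t) ¬moved

      true⇒agree : ∀ g k → T (g k) → value g (s (suc k)) ≡ zero
      true⇒agree g k t with em {P = Moved g (s (suc k))}
      ... | yes (j , eq , ¬t) = contradiction (subst (T ∘ g) (sym (suc-injective (s-injective eq))) t) ¬t
      ... | no _ = refl

    -- Nonemptiness and the finite cases

    𝒯-satisfiable : ∀ n → ∃ 𝒯[ L , suc n ]
    𝒯-satisfiable n = Th (onFin n R F) , Th-onFin n R F
      where
      R = λ _ _ → ⊤
      F = λ _ _ → lift zero

    enumeratedModel : ∀ {n} → ∃ 𝒯[ L , n ] → ∃ λ (M : Structure L) → HasCardinality M n
    enumeratedModel (_ , M , _ , ι) = M , ι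

    -- Each member of the family carries an enumerated model. Finitely many atoms have finitely many
    -- truth patterns, and models with the same pattern have the same theory, so one member per
    -- pattern suffices. A theory may recur under different enumerations, which is harmless.
    finite-if-determined : ∀ {n} {I : Set ℓ} (A : I → Atom L n) → FiniteSet I →
      (∀ x y → (∀ i → Holds x (A i) ⇔ Holds y (A i)) → ∀ B → Holds x B ⇔ Holds y B) →
      FiniteFamily 𝒯[ L , n ]
    finite-if-determined A fin determined =
      let Ts , cover = classify (λ i → (λ x → Holds x (A i)) ∘ enumeratedModel) fin in
      Ts , λ T → Any.map (λ {T′} h → same T T′ (determined _ _ h)) (cover T)
      where
      same : ∀ T T′ → (∀ B → Holds (enumeratedModel T) B ⇔ Holds (enumeratedModel T′) B) → _
      same (T , M , M⊨T , ι) (T′ , M′ , M′⊨T′ , ι′) h =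
        (λ {φ} → model⇒∈ T′ M′⊨T′ ∘ to (equivalent φ) ∘ M⊨T φ) ,
        (λ {φ} → model⇒∈ T M⊨T ∘ from (equivalent φ) ∘ M′⊨T′ φ)
        where equivalent = λ φ → atoms-determine M M′ ι ι′ h φ []

    finite-language⇒finite : ∀ n → FiniteLanguage L → FiniteFamily 𝒯[ L , n ]
    finite-language⇒finite n (finP , finF) =
      finite-if-determined id
        (⊎-finite (Σ-finite finP λ _ → Vec-finite (Fin-finite n) _)
                  (Σ-finite finF λ _ → Σ-finite (Vec-finite (Fin-finite n) _) λ _ → Fin-finite n))
        (λ _ _ → id)

    finite-predicates⇒finite : FiniteSet PredSym → FiniteFamily 𝒯[ L , 1 ]
    finite-predicates⇒finite finP =
      finite-if-determined inj₁ (Σ-finite finP λ _ → Vec-finite (Fin-finite 1) _)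
        λ { x y h (inj₁ A) → h A
          -- In a one-element model every graph atom is true, so the predicate atoms decide
          -- everything.
          ; (M , ι) (M′ , ι′) h (inj₂ _) → mk⇔ (λ _ → singleton {M′} ι′) (λ _ → singleton {M} ι) }
      where
      Fin1-singleton : {i j : Fin 1} → i ≡ j
      Fin1-singleton {zero} {zero} = refl

      singleton : ∀ {N : Structure L} (κ : HasCardinality N 1) {x y : Structure.Carrier N} → x ≡ y
      singleton κ = Injection.injective (↔⇒↣ κ) Fin1-singleton

theorem3p1 : (∀ {a : Level} → ExcludedMiddle a) →
    ∀ {ℓ : Level} (o : Level) (L : Language ℓ) (n : ℕ) → n ≥ 1 →
    (FiniteLanguage L ⊎ (n ≡ 1 × FiniteSet (Language.PredSym L)) →
    RS 𝒯[ L , n ] ≈ ord {o} zero)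
    ×
    (¬ (FiniteLanguage L ⊎ (n ≡ 1 × FiniteSet (Language.PredSym L))) →
    RS 𝒯[ L , n ] ≈ ∞ᵣ {o})
theorem3p1 em o L (suc n) n≥1 = rank-zero , rank-infinite n
  where
  open Language L

  rank-zero : FiniteLanguage L ⊎ (suc n ≡ 1 × FiniteSet PredSym) → RS 𝒯[ L , suc n ] ≈ ord {o} zero
  rank-zero (inj₁ fin)           = finite (𝒯-satisfiable em L n) (finite-language⇒finite em L (suc n) fin)
  rank-zero (inj₂ (refl , finP)) = finite (𝒯-satisfiable em L 0) (finite-predicates⇒finite em L finP)

  rank-infinite : ∀ n → ¬ (FiniteLanguage L ⊎ (suc n ≡ 1 × FiniteSet PredSym)) → RS 𝒯[ L , suc n ] ≈ ∞ᵣ {o}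
  rank-infinite n inf with em {P = FiniteSet PredSym}
  rank-infinite n       inf | no infP  = independent⇒RS≈∞ em (predicates-independent em L n infP)
  rank-infinite zero    inf | yes finP = contradiction (inj₂ (refl , finP)) inf
  -- With at least two elements and finitely many predicate symbols, the hypothesis can only hold
  -- through infinitely many function symbols.
  rank-infinite (suc n) inf | yes finP =
    independent⇒RS≈∞ em (functions-independent em L n λ finF → inf (inj₁ (finP , finF)))
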